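{- Let $\vdash$ be the consequence relation of the logic $R4^\star$ and let $\mathrm{Fml}$ be the algebra of formulas in the language $\{\to,\vee,\wedge,\neg\}$. For every $\Gamma\cup\{\alpha\}\subseteq\mathrm{Fml}$: $\Gamma\vdash\alpha$ if and only if for every subresiduated lattice $A$ and every homomorphism $h:\mathrm{Fml}\to A$ (where $\neg$ is interpreted in $A$ as $\neg x:=x\to 0$), $h(\Gamma)\subseteq\{1\}$ implies $h(\alpha)=1$.
   Context: The logic $R4^\star$ is the Hilbert-style calculus in the language $\{\to,\vee,\wedge,\neg\}$ with axiom schemes: (Ax1) $\alpha\to\alpha$; (Ax2) $(\alpha\to\beta)\to((\beta\to\delta)\to(\alpha\to\delta))$; (Ax3) $(\alpha\to(\beta\to\delta))\to((\alpha\to\beta)\to(\alpha\to\delta))$; (C1) $(\alpha\wedge\beta)\to\alpha$; (C2) $(\alpha\wedge\beta)\to\beta$; (C3) $(\delta\to\alpha)\to((\delta\to\beta)\to(\delta\to(\alpha\wedge\beta)))$; (D1) $\alpha\to(\alpha\vee\beta)$; (D2) $\beta\to(\alpha\vee\beta)$; (D3) $(\alpha\to\delta)\to((\beta\to\delta)\to((\alpha\vee\beta)\to\delta))$; (N1) $\neg\alpha\to(\alpha\to\beta)$; (N2) $(\alpha\to\neg\alpha)\to\neg\alpha$; (Dist) $(\alpha\wedge(\beta\vee\delta))\to((\alpha\wedge\beta)\vee(\alpha\wedge\delta))$; and rules (MP) from $\alpha$ and $\alpha\to\beta$ infer $\beta$; (T) from $\alpha$ infer $\beta\to\alpha$. $\Gamma\vdash\alpha$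 means there is a finite derivation of $\alpha$ from premises in $\Gamma$ (both rules may be applied to any previously derived formulas, including those depending on premises). A subresiduated lattice is an algebra $(A,\wedge,\vee,\to,0,1)$ of type $(2,2,2,0,0)$ such that $(A,\wedge,\vee,0,1)$ is a bounded distributive lattice and for all $x,y,z\in A$: $x\to x=1$; $x\to y\le z\to(x\to y)$; $x\wedge(x\to y)\le y$; $z\to(x\wedge y)=(z\to x)\wedge(z\to y)$; $(x\vee y)\to z=(x\to z)\wedge(y\to z)$; $(x\to y)\wedge(y\to z)\le x\to z$. -}

module Defs where

open import Level using (Level; _⊔_; suc)
open import Algebra.Core using (Op₁; Op₂)
open import Algebra.Definitions using (Congruent₂)
open import Algebra.Lattice.Structures using (IsDistributiveLattice)
open import Relation.Binary.Core using (Rel)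
open import Relation.Unary using (Pred; _∈_)
import Relation.Binary.Construct.NaturalOrder.Left as NaturalOrder

-- The absolutely free algebra in the language {→, ∨, ∧, ¬} over the
-- propositional variables Var; there are no constants.

infix  9 ¬′_
infixr 8 _∧′_
infixr 7 _∨′_
infixr 6 _⇒_

data Fml {v : Level} (Var : Set v) : Set v where
  var  : Var → Fml Var
  _⇒_  : Fml Var → Fml Var → Fml Var
  _∨′_ : Fml Var → Fml Var → Fml Var
  _∧′_ : Fml Var → Fml Var → Fml Var
  ¬′_  : Fml Var → Fml Var

data Axiom {v : Level} {Var : Set v} : Pred (Fml Var) v where
  Ax1  : ∀ α     → Axiom (α ⇒ α)
  Ax2  : ∀ α β δ → Axiom ((α ⇒ β) ⇒ ((β ⇒ δ) ⇒ (α ⇒ δ)))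
  Ax3  : ∀ α β δ → Axiom ((α ⇒ (β ⇒ δ)) ⇒ ((α ⇒ β) ⇒ (α ⇒ δ)))
  C1   : ∀ α β   → Axiom ((α ∧′ β) ⇒ α)
  C2   : ∀ α β   → Axiom ((α ∧′ β) ⇒ β)
  C3   : ∀ α β δ → Axiom ((δ ⇒ α) ⇒ ((δ ⇒ β) ⇒ (δ ⇒ (α ∧′ β))))
  D1   : ∀ α β   → Axiom (α ⇒ (α ∨′ β))
  D2   : ∀ α β   → Axiom (β ⇒ (α ∨′ β))
  D3   : ∀ α β δ → Axiom ((α ⇒ δ) ⇒ ((β ⇒ δ) ⇒ ((α ∨′ β) ⇒ δ)))
  N1   : ∀ α β   → Axiom ((¬′ α) ⇒ (α ⇒ β))
  N2   : ∀ α     → Axiom ((α ⇒ (¬′ α)) ⇒ (¬′ α))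
  Dist : ∀ α β δ → Axiom ((α ∧′ (β ∨′ δ)) ⇒ ((α ∧′ β) ∨′ (α ∧′ δ)))

-- Γ ⊢ α is the type of finite derivations (as trees) of α from Γ. Both
-- rules apply to arbitrary derived formulas; T is not restricted to theorems.

infix 4 _⊢_

data _⊢_ {v p : Level} {Var : Set v} (Γ : Pred (Fml Var) p) : Pred (Fml Var) (v ⊔ p) where
  premise : ∀ {α}   → α ∈ Γ → Γ ⊢ α
  axiom   : ∀ {α}   → Axiom α → Γ ⊢ α
  MP      : ∀ {α β} → Γ ⊢ α → Γ ⊢ α ⇒ β → Γ ⊢ β
  T       : ∀ {α β} → Γ ⊢ α → Γ ⊢ β ⇒ α

-- As elsewhere in the library, the equality of an algebra is an equivalence
-- relation _≈_ respected by all the operations.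

record SubresiduatedLattice (c ℓ : Level) : Set (suc (c ⊔ ℓ)) where
  infix  4 _≈_
  infixr 7 _∧_
  infixr 6 _∨_
  infixr 5 _⟶_
  field
    Carrier : Set c
    _≈_     : Rel Carrier ℓ
    _∧_     : Op₂ Carrier
    _∨_     : Op₂ Carrier
    _⟶_     : Op₂ Carrier
    0#      : Carrier
    1#      : Carrier

  -- The lattice order: x ≤ y is x ≈ x ∧ y.
  open NaturalOrder _≈_ _∧_ public using (_≤_)

  field
    isDistributiveLattice : IsDistributiveLattice _≈_ _∨_ _∧_
    0#-minimum            : ∀ x → 0# ≤ x
    1#-maximum            : ∀ x → x ≤ 1#
    ⟶-cong                : Congruent₂ _≈_ _⟶_
    ⟶-refl                : ∀ x → (x ⟶ x) ≈ 1#
    ⟶-weaken              : ∀ x y z → (x ⟶ y) ≤ (z ⟶ (x ⟶ y))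
    ⟶-mp                  : ∀ x y → (x ∧ (x ⟶ y)) ≤ y
    ⟶-distribˡ-∧          : ∀ x y z → (z ⟶ (x ∧ y)) ≈ ((z ⟶ x) ∧ (z ⟶ y))
    ⟶-distribʳ-∨          : ∀ x y z → ((x ∨ y) ⟶ z) ≈ ((x ⟶ z) ∧ (y ⟶ z))
    ⟶-trans               : ∀ x y z → ((x ⟶ y) ∧ (y ⟶ z)) ≤ (x ⟶ z)

  open IsDistributiveLattice isDistributiveLattice public

  infix 8 ~_
  ~_ : Op₁ Carrier
  ~ x = x ⟶ 0#

record IsHomomorphism {v c ℓ : Level} {Var : Set v} (A : SubresiduatedLattice c ℓ)
                      (h : Fml Var → SubresiduatedLattice.Carrier A) : Set (v ⊔ ℓ) where
  open SubresiduatedLattice A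
  field
    ⇒-homo : ∀ α β → h (α ⇒ β) ≈ (h α ⟶ h β)
    ∨-homo : ∀ α β → h (α ∨′ β) ≈ (h α ∨ h β)
    ∧-homo : ∀ α β → h (α ∧′ β) ≈ (h α ∧ h β)
    ¬-homo : ∀ α → h (¬′ α) ≈ (~ h α)

{-# OPTIONS --safe #-}

-- Soundness: call d persistent when d ≤ z ⟶ d for all z. All x ⟶ y are
-- persistent, persistence is closed under meets, and for persistent d the meet
-- with d is residuated: d ∧ x ≤ y gives d ≤ x ⟶ y. Hence a natural-deduction
-- argument is available for each axiom, because every hypothesis other than
-- the innermost one discharged is an implication or a negation.
-- Completeness: formulas ordered by Γ ⊢ φ ⇒ ψ form a subresiduated lattice, in
-- which the identity valuation sends exactly the consequences of Γ to 1#.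
module Submission where

open import Defs
open import Level using (Level; _⊔_; Lift; lift; lower)
open import Algebra.Lattice.Bundles using (Lattice)
import Algebra.Lattice.Properties.Lattice as AlgLatticeProperties
open import Data.Product.Base using (_,_)
open import Function.Bundles using (_⇔_; mk⇔)
open import Relation.Binary.Bundles using (Poset)
open import Relation.Binary.Construct.Interior.Symmetric as Symmetric using (SymInterior; _,_)
open import Relation.Binary.Core using (Rel)
open import Relation.Binary.Lattice using (DistributiveLattice; IsLattice)
import Relation.Binary.Lattice.Properties.DistributiveLattice as DistributiveProperties
import Relation.Binary.Lattice.Properties.Lattice as LatticeProperties
open import Relation.Unary using (Pred; _∈_)

-- Persistent elements and residuation.

module Residuation {a b} (A : SubresiduatedLattice a b) where
  open SubresiduatedLattice A

  lattice : Lattice a b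
  lattice = record { isLattice = isLattice }

  open AlgLatticeProperties lattice public using (poset; ∨-∧-isOrderTheoreticLattice)
  open Poset poset public using (≤-respʳ-≈; ≤-respˡ-≈; antisym)
    renaming (refl to ≤-refl; trans to ≤-trans; reflexive to ≤-reflexive)
  open IsLattice ∨-∧-isOrderTheoreticLattice public
    using (x∧y≤x; x∧y≤y; ∧-greatest; x≤x∨y; y≤x∨y; ∨-least)

  -- Since `x ≤ y` is `x ≈ x ∧ y`, applying `z ⟶_` and distributing it over the meet gives the
  -- claim.
  ⟶-monoʳ : ∀ z {x y} → x ≤ y → (z ⟶ x) ≤ (z ⟶ y)
  ⟶-monoʳ z {x} {y} x≤y = trans (⟶-cong refl x≤y) (⟶-distribˡ-∧ x y z)

  -- Equivalently `d ≈ 1# ⟶ d`, by `⟶-mp` and `⟶-weaken`: the open elements of the box operator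
  -- `1# ⟶_`.
  Persistent : Carrier → Set (a ⊔ b)
  Persistent d = ∀ z → d ≤ (z ⟶ d)

  ⟶-persistent : ∀ x y → Persistent (x ⟶ y)
  ⟶-persistent = ⟶-weaken

  persistent-resp-≈ : ∀ {d e} → d ≈ e → Persistent d → Persistent e
  persistent-resp-≈ d≈e p z = ≤-respˡ-≈ d≈e (≤-respʳ-≈ (⟶-cong refl d≈e) (p z))

  ∧-persistent : ∀ {d e} → Persistent d → Persistent e → Persistent (d ∧ e)
  ∧-persistent {d} {e} p q z = ≤-respʳ-≈ (sym (⟶-distribˡ-∧ d e z))
    (∧-greatest (≤-trans (x∧y≤x d e) (p z)) (≤-trans (x∧y≤y d e) (q z)))

  -- Persistence gives `d ≤ x ⟶ d`, and `x ⟶ x` is the top, so `d ≤ x ⟶ (d ∧ x)`; monotonicity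
  -- finishes.
  residuate : ∀ {d x y} → Persistent d → (d ∧ x) ≤ y → d ≤ (x ⟶ y)
  residuate {d} {x} {y} p d∧x≤y = ≤-trans
    (≤-respʳ-≈ (sym (⟶-distribˡ-∧ d x x))
      (∧-greatest (p x) (≤-respʳ-≈ (sym (⟶-refl x)) (1#-maximum d))))
    (⟶-monoʳ x d∧x≤y)

  1≤⇒≈1 : ∀ {x} → 1# ≤ x → x ≈ 1#
  1≤⇒≈1 1≤x = antisym (1#-maximum _) 1≤x

  ≤⇒⟶≈1 : ∀ {x y} → x ≤ y → (x ⟶ y) ≈ 1#
  ≤⇒⟶≈1 {x} x≤y = 1≤⇒≈1 (≤-respˡ-≈ (⟶-refl x) (⟶-monoʳ x x≤y))

-- Natural deduction in an algebra, and soundness.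

module Soundness {v a b} {Var : Set v} (A : SubresiduatedLattice a b)
                 {h : Fml Var → SubresiduatedLattice.Carrier A} (hom : IsHomomorphism A h) where
  open SubresiduatedLattice A
  open Residuation A
  open IsHomomorphism hom

  infix 4 _⊩_

  -- The element `d` plays the role of a context: the meet of the open hypotheses.
  _⊩_ : Carrier → Fml Var → Set b
  d ⊩ α = d ≤ h α

  ⇒-persistent : ∀ α β → Persistent (h (α ⇒ β))
  ⇒-persistent α β = persistent-resp-≈ (sym (⇒-homo α β)) (⟶-persistent (h α) (h β))

  ⇒-intro : ∀ {d α β} → Persistent d → d ∧ h α ⊩ β → d ⊩ α ⇒ β
  ⇒-intro p s = ≤-respʳ-≈ (sym (⇒-homo _ _)) (residuate p s)

  ⇒-elim : ∀ {d α β} → d ⊩ α ⇒ β → d ⊩ α → d ⊩ β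
  ⇒-elim s t = ≤-trans (∧-greatest t (≤-respʳ-≈ (⇒-homo _ _) s)) (⟶-mp _ _)

  ∧-intro : ∀ {d α β} → d ⊩ α → d ⊩ β → d ⊩ α ∧′ β
  ∧-intro s t = ≤-respʳ-≈ (sym (∧-homo _ _)) (∧-greatest s t)

  ∧-elim₁ : ∀ {d α β} → d ⊩ α ∧′ β → d ⊩ α
  ∧-elim₁ s = ≤-trans (≤-respʳ-≈ (∧-homo _ _) s) (x∧y≤x _ _)

  ∧-elim₂ : ∀ {d α β} → d ⊩ α ∧′ β → d ⊩ β
  ∧-elim₂ s = ≤-trans (≤-respʳ-≈ (∧-homo _ _) s) (x∧y≤y _ _)

  ∨-intro₁ : ∀ {d α β} → d ⊩ α → d ⊩ α ∨′ β
  ∨-intro₁ s = ≤-respʳ-≈ (sym (∨-homo _ _)) (≤-trans s (x≤x∨y _ _))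

  ∨-intro₂ : ∀ {d α β} → d ⊩ β → d ⊩ α ∨′ β
  ∨-intro₂ s = ≤-respʳ-≈ (sym (∨-homo _ _)) (≤-trans s (y≤x∨y _ _))

  -- Distributivity splits `d ∧ (h α ∨ h β)`, so the context may be arbitrary here.
  ∨-elim : ∀ {d α β δ} → d ⊩ α ∨′ β → d ∧ h α ⊩ δ → d ∧ h β ⊩ δ → d ⊩ δ
  ∨-elim {d} s t u = ≤-trans (∧-greatest ≤-refl (≤-respʳ-≈ (∨-homo _ _) s))
    (≤-respˡ-≈ (sym (∧-distribˡ-∨ d _ _)) (∨-least t u))

  ¬-intro : ∀ {d α} → Persistent d → d ∧ h α ≤ 0# → d ⊩ ¬′ α
  ¬-intro p s = ≤-respʳ-≈ (sym (¬-homo _)) (residuate p s)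

  ¬-elim : ∀ {d α} → d ⊩ ¬′ α → d ⊩ α → d ≤ 0#
  ¬-elim s t = ≤-trans (∧-greatest t (≤-respʳ-≈ (¬-homo _) s)) (⟶-mp _ _)

  hyp : ∀ {d α} → d ∧ h α ⊩ α
  hyp = x∧y≤y _ _

  weaken : ∀ {d x α} → d ⊩ α → d ∧ x ⊩ α
  weaken s = ≤-trans (x∧y≤x _ _) s

  -- Discharges the outermost hypothesis, which may be any formula because no other hypothesis
  -- remains.
  ⊩⇒≈1 : ∀ {α β} → h α ⊩ β → h (α ⇒ β) ≈ 1#
  ⊩⇒≈1 s = trans (⇒-homo _ _) (≤⇒⟶≈1 s)

  -- Hypotheses are addressed as by de Bruijn indices: `hyp` is the innermost, each `weaken` moves
  -- one step out, and `≤-refl` reaches the outermost.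
  axiom-sound : ∀ {α} → Axiom α → h α ≈ 1#
  axiom-sound (Ax1 α)     = ⊩⇒≈1 ≤-refl
  axiom-sound (Ax2 α β δ) = ⊩⇒≈1
    (⇒-intro (⇒-persistent α β)
      (⇒-intro (∧-persistent (⇒-persistent α β) (⇒-persistent β δ))
        (⇒-elim (weaken hyp) (⇒-elim (weaken (weaken ≤-refl)) hyp))))
  axiom-sound (Ax3 α β δ) = ⊩⇒≈1
    (⇒-intro (⇒-persistent α (β ⇒ δ))
      (⇒-intro (∧-persistent (⇒-persistent α (β ⇒ δ)) (⇒-persistent α β))
        (⇒-elim (⇒-elim (weaken (weaken ≤-refl)) hyp) (⇒-elim (weaken hyp) hyp))))
  axiom-sound (C1 α β)    = ⊩⇒≈1 (∧-elim₁ ≤-refl)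
  axiom-sound (C2 α β)    = ⊩⇒≈1 (∧-elim₂ ≤-refl)
  axiom-sound (C3 α β δ)  = ⊩⇒≈1
    (⇒-intro (⇒-persistent δ α)
      (⇒-intro (∧-persistent (⇒-persistent δ α) (⇒-persistent δ β))
        (∧-intro (⇒-elim (weaken (weaken ≤-refl)) hyp) (⇒-elim (weaken hyp) hyp))))
  axiom-sound (D1 α β)    = ⊩⇒≈1 (∨-intro₁ ≤-refl)
  axiom-sound (D2 α β)    = ⊩⇒≈1 (∨-intro₂ ≤-refl)
  axiom-sound (D3 α β δ)  = ⊩⇒≈1
    (⇒-intro (⇒-persistent α δ)
      (⇒-intro (∧-persistent (⇒-persistent α δ) (⇒-persistent β δ))
        (∨-elim hyp (⇒-elim (weaken (weaken (weaken ≤-refl))) hyp)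
                    (⇒-elim (weaken (weaken hyp)) hyp))))
  axiom-sound (N1 α β)    = ⊩⇒≈1
    (⇒-intro (persistent-resp-≈ (sym (¬-homo α)) (⟶-persistent (h α) 0#))
      (≤-trans (¬-elim (weaken ≤-refl) hyp) (0#-minimum (h β))))
  axiom-sound (N2 α)      = ⊩⇒≈1
    (¬-intro (⇒-persistent α (¬′ α)) (¬-elim (⇒-elim (weaken ≤-refl) hyp) hyp))
  axiom-sound (Dist α β δ) = ⊩⇒≈1
    (∨-elim (∧-elim₂ ≤-refl) (∨-intro₁ (∧-intro (weaken (∧-elim₁ ≤-refl)) hyp))
                             (∨-intro₂ (∧-intro (weaken (∧-elim₁ ≤-refl)) hyp)))

  ⊢-sound : ∀ {p} {Γ : Pred (Fml Var) p} → (∀ {γ} → γ ∈ Γ → h γ ≈ 1#) → ∀ {α} → Γ ⊢ α → h α ≈ 1#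
  ⊢-sound Γ≈1 (premise α∈Γ) = Γ≈1 α∈Γ
  ⊢-sound Γ≈1 (axiom ax)    = axiom-sound ax
  ⊢-sound Γ≈1 (MP d e)      = 1≤⇒≈1
    (⇒-elim (≤-reflexive (sym (⊢-sound Γ≈1 e))) (≤-reflexive (sym (⊢-sound Γ≈1 d))))
  -- The conclusion of T has a consequent of value `1#`, whether or not `d` uses premises.
  ⊢-sound Γ≈1 (T d)         = ⊩⇒≈1 (≤-respʳ-≈ (sym (⊢-sound Γ≈1 d)) (1#-maximum _))

-- Derived rules of the calculus.

module Derivations {v p} {Var : Set v} (Γ : Pred (Fml Var) p) where

  private variable
    α β γ δ : Fml Var

  ⊢-refl : Γ ⊢ α ⇒ α
  ⊢-refl = axiom (Ax1 _)

  ⊢-trans : Γ ⊢ α ⇒ β → Γ ⊢ β ⇒ γ → Γ ⊢ α ⇒ γ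
  ⊢-trans d e = MP e (MP d (axiom (Ax2 _ _ _)))

  ⊢-apply : Γ ⊢ γ ⇒ (α ⇒ β) → Γ ⊢ γ ⇒ α → Γ ⊢ γ ⇒ β
  ⊢-apply d e = MP e (MP d (axiom (Ax3 _ _ _)))

  ⊢-∧-greatest : Γ ⊢ γ ⇒ α → Γ ⊢ γ ⇒ β → Γ ⊢ γ ⇒ (α ∧′ β)
  ⊢-∧-greatest d e = MP e (MP d (axiom (C3 _ _ _)))

  ⊢-∨-least : Γ ⊢ α ⇒ γ → Γ ⊢ β ⇒ γ → Γ ⊢ (α ∨′ β) ⇒ γ
  ⊢-∨-least d e = MP e (MP d (axiom (D3 _ _ _)))

  -- Ax2 changes the antecedent; for the consequent, T puts `γ` in front of `β ⇒ δ` and Ax3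
  -- distributes it.
  ⊢-⇒-mono : Γ ⊢ γ ⇒ α → Γ ⊢ β ⇒ δ → Γ ⊢ (α ⇒ β) ⇒ (γ ⇒ δ)
  ⊢-⇒-mono d e = ⊢-trans (MP d (axiom (Ax2 _ _ _))) (MP (T e) (axiom (Ax3 _ _ _)))

  ⊢-⇒-trans : Γ ⊢ γ ⇒ (α ⇒ β) → Γ ⊢ γ ⇒ (β ⇒ δ) → Γ ⊢ γ ⇒ (α ⇒ δ)
  ⊢-⇒-trans d e = ⊢-apply (⊢-trans d (axiom (Ax2 _ _ _))) e

  -- α ⇒ β entails (β ⇒ β) ⇒ (α ⇒ β) by Ax2, and γ entails the theorem β ⇒ β.
  ⊢-⇒-weaken : Γ ⊢ (α ⇒ β) ⇒ (γ ⇒ (α ⇒ β))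
  ⊢-⇒-weaken = ⊢-trans (axiom (Ax2 _ _ _)) (⊢-⇒-mono (T ⊢-refl) ⊢-refl)

  ⊢-mp : Γ ⊢ (α ∧′ (α ⇒ β)) ⇒ β
  ⊢-mp = ⊢-apply (axiom (C2 _ _)) (axiom (C1 _ _))

  ⊢-explosion : Γ ⊢ α → Γ ⊢ ¬′ α ⇒ β
  ⊢-explosion d = ⊢-apply (axiom (N1 _ _)) (T d)

  -- A formula `δ` implying everything implies `¬′ α`, so `α ⇒ δ` yields `α ⇒ ¬′ α`, and N2 applies.
  ⊢-¬-intro : (∀ β → Γ ⊢ δ ⇒ β) → Γ ⊢ (α ⇒ δ) ⇒ ¬′ α
  ⊢-¬-intro δ⇒ = ⊢-trans (⊢-⇒-mono ⊢-refl (δ⇒ _)) (axiom (N2 _))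

-- The Lindenbaum algebra.

-- The language has no constants, and no formula at all when Var is empty: 0# and
-- 1# are built from a given formula τ.
module Lindenbaum {v p} (c ℓ : Level) {Var : Set v} (Γ : Pred (Fml Var) p) (τ : Fml Var) where
  open Derivations Γ

  -- The lifts here and in `_≼_` place the algebra at the universe levels over which the theorem
  -- quantifies.
  Carrier : Set (v ⊔ c)
  Carrier = Lift c (Fml Var)

  infix 4 _≼_ _≈_

  _≼_ : Rel Carrier (v ⊔ p ⊔ ℓ)
  x ≼ y = Lift ℓ (Γ ⊢ lower x ⇒ lower y)

  _≈_ : Rel Carrier (v ⊔ p ⊔ ℓ)
  _≈_ = SymInterior _≼_

  _∧_ _∨_ _⟶_ : Carrier → Carrier → Carrier
  lift α ∧ lift β = lift (α ∧′ β)
  lift α ∨ lift β = lift (α ∨′ β)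
  lift α ⟶ lift β = lift (α ⇒ β)

  0# 1# : Carrier
  0# = lift (¬′ (τ ⇒ τ))
  1# = lift (τ ⇒ τ)

  ≼-isLattice : IsLattice _≈_ _≼_ _∨_ _∧_
  ≼-isLattice = record
    { isPartialOrder = Symmetric.isPartialOrder (lift ⊢-refl) λ (lift d) (lift e) → lift (⊢-trans d e)
    ; supremum = λ _ _ → lift (axiom (D1 _ _)) , lift (axiom (D2 _ _)) ,
                         λ _ (lift d) (lift e) → lift (⊢-∨-least d e)
    ; infimum  = λ _ _ → lift (axiom (C1 _ _)) , lift (axiom (C2 _ _)) ,
                         λ _ (lift d) (lift e) → lift (⊢-∧-greatest d e)
    }

  open IsLattice ≼-isLattice using (antisym; refl; ∨-least; ∧-greatest; x∧y≤x)

  distributiveLattice : DistributiveLattice (v ⊔ c) (v ⊔ p ⊔ ℓ) (v ⊔ p ⊔ ℓ)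
  distributiveLattice = record
    { isDistributiveLattice = record
      { isLattice    = ≼-isLattice
      ; ∧-distribˡ-∨ = λ x y z → antisym (lift (axiom (Dist _ _ _)))
          (∨-least (∧-greatest (x∧y≤x x y) (lift (⊢-trans (axiom (C2 _ _)) (axiom (D1 _ _)))))
                   (∧-greatest (x∧y≤x x z) (lift (⊢-trans (axiom (C2 _ _)) (axiom (D2 _ _))))))
      }
    }

  ≼⇒≈∧ : ∀ {x y} → Γ ⊢ lower x ⇒ lower y → x ≈ x ∧ y
  ≼⇒≈∧ d = antisym (∧-greatest refl (lift d)) (x∧y≤x _ _)

  algebra : SubresiduatedLattice (v ⊔ c) (v ⊔ p ⊔ ℓ)
  algebra = record
    { Carrier = Carrier
    ; _≈_ = _≈_
    ; _∧_ = _∧_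
    ; _∨_ = _∨_
    ; _⟶_ = _⟶_
    ; 0# = 0#
    ; 1# = 1#
    ; isDistributiveLattice = record
      { isLattice   = LatticeProperties.isAlgLattice (DistributiveLattice.lattice distributiveLattice)
      ; ∨-distrib-∧ = DistributiveProperties.∨-distrib-∧ distributiveLattice
      ; ∧-distrib-∨ = DistributiveProperties.∧-distrib-∨ distributiveLattice
      }
    ; 0#-minimum   = λ _ → ≼⇒≈∧ (⊢-explosion ⊢-refl)
    ; 1#-maximum   = λ _ → ≼⇒≈∧ (T ⊢-refl)
    ; ⟶-cong       = λ (lift d , lift d′) (lift e , lift e′) →
                       lift (⊢-⇒-mono d′ e) , lift (⊢-⇒-mono d e′)
    ; ⟶-refl       = λ _ → lift (T ⊢-refl) , lift (T ⊢-refl)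
    ; ⟶-weaken     = λ _ _ _ → ≼⇒≈∧ ⊢-⇒-weaken
    ; ⟶-mp         = λ _ _ → ≼⇒≈∧ ⊢-mp
    ; ⟶-distribˡ-∧ = λ _ _ _ → antisym
        (∧-greatest (lift (⊢-⇒-mono ⊢-refl (axiom (C1 _ _)))) (lift (⊢-⇒-mono ⊢-refl (axiom (C2 _ _)))))
        -- C3 is curried: the first conjunct is its first argument, and Ax3 supplies the second
        -- conjunct under the same antecedent.
        (lift (⊢-apply (⊢-trans (axiom (C1 _ _)) (axiom (C3 _ _ _))) (axiom (C2 _ _))))
    ; ⟶-distribʳ-∨ = λ _ _ _ → antisym
        (∧-greatest (lift (⊢-⇒-mono (axiom (D1 _ _)) ⊢-refl)) (lift (⊢-⇒-mono (axiom (D2 _ _)) ⊢-refl)))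
        (lift (⊢-apply (⊢-trans (axiom (C1 _ _)) (axiom (D3 _ _ _))) (axiom (C2 _ _))))
    ; ⟶-trans      = λ _ _ _ → ≼⇒≈∧ (⊢-⇒-trans (axiom (C1 _ _)) (axiom (C2 _ _)))
    }

  lift-isHomomorphism : IsHomomorphism algebra lift
  lift-isHomomorphism = record
    { ⇒-homo = λ _ _ → ≈-refl
    ; ∨-homo = λ _ _ → ≈-refl
    ; ∧-homo = λ _ _ → ≈-refl
    ; ¬-homo = λ _ → lift (axiom (N1 _ _)) , lift (⊢-¬-intro λ _ → ⊢-explosion ⊢-refl)
    }
    where
    ≈-refl : ∀ {x} → x ≈ x
    ≈-refl = refl , refl

  -- T is applied to a derivation that may use premises; this is how members of `Γ` come to have
  -- value `1#`.
  ⊢⇒≈1 : ∀ {α} → Γ ⊢ α → lift α ≈ 1#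
  ⊢⇒≈1 d = lift (T ⊢-refl) , lift (T d)

  ≈1⇒⊢ : ∀ {α} → lift α ≈ 1# → Γ ⊢ α
  ≈1⇒⊢ (_ , lift d) = MP ⊢-refl d

-- Soundness and completeness combined.

SemanticConsequence : ∀ {v p} (a b : Level) {Var : Set v} → Pred (Fml Var) p → Fml Var → Set _
SemanticConsequence a b {Var} Γ α =
  (A : SubresiduatedLattice a b) →
  (h : Fml Var → SubresiduatedLattice.Carrier A) →
  IsHomomorphism A h →
  (∀ {γ} → γ ∈ Γ → SubresiduatedLattice._≈_ A (h γ) (SubresiduatedLattice.1# A)) →
  SubresiduatedLattice._≈_ A (h α) (SubresiduatedLattice.1# A)

soundness : ∀ {v p a b} {Var : Set v} {Γ : Pred (Fml Var) p} {α} →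
            Γ ⊢ α → SemanticConsequence a b Γ α
soundness d A h hom Γ≈1 = Soundness.⊢-sound A hom Γ≈1 d

completeness : ∀ {v p} (c ℓ : Level) {Var : Set v} {Γ : Pred (Fml Var) p} {α} →
               SemanticConsequence (v ⊔ c) (v ⊔ p ⊔ ℓ) Γ α → Γ ⊢ α
completeness c ℓ {Γ = Γ} {α} valid =
  ≈1⇒⊢ (valid algebra lift lift-isHomomorphism (λ γ∈Γ → ⊢⇒≈1 (premise γ∈Γ)))
  -- The formula `α` itself serves as `τ`, which covers an empty `Var`.
  where open Lindenbaum c ℓ Γ α

corollary5p15 : {v p : Level} (c ℓ : Level) (Var : Set v) (Γ : Pred (Fml Var) p) (α : Fml Var) →
    (Γ ⊢ α) ⇔
    ((A : SubresiduatedLattice (v ⊔ c) (v ⊔ p ⊔ ℓ)) →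
    (h : Fml Var → SubresiduatedLattice.Carrier A) →
    IsHomomorphism A h →
    (∀ {γ} → γ ∈ Γ → SubresiduatedLattice._≈_ A (h γ) (SubresiduatedLattice.1# A)) →
    SubresiduatedLattice._≈_ A (h α) (SubresiduatedLattice.1# A))
corollary5p15 c ℓ Var Γ α = mk⇔ soundness (completeness c ℓ)
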